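{- Let $m \geq 3$ be an integer. Then $\alpha(C(W_{m,1}))=\alpha(C(C_m))+1$.
   Context: Graphs are finite and simple. For a graph $G$, the pair graph $C(G)$ (also called complete double vertex graph) is the graph whose vertices are all $2$-multisets of $V(G)$ (so $\{x,x\}$ is allowed), where two vertices $\{x,y\}$ and $\{u,v\}$ are adjacent if and only if $\{x,y\}\cap\{u,v\}=\{a\}$ (multiset intersection) for some $a$ and, writing $x=u=a$, the vertices $y$ and $v$ are adjacent in $G$; that is, the two multisets can be written as $\{a,y\}$ and $\{a,v\}$ with $yv$ an edge of $G$. $C_m$ is the cycle with $m$ vertices, and $C(C_m)$ is its pair graph. The wheel graph $W_{m,1}$ is the join $C_m+K_1$, where $K_1$ is the complete graph with one vertex (the join of two disjoint graphs adds all edges between them). $\alpha(G)$ denotes the independence number of $G$. -}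

module Defs where

open import Data.Fin.Base using (Fin; toℕ)
import Data.Fin.Properties as Fin
open import Data.List.Base
  using (List; []; _∷_; _++_; map; filter; length; allFin; cartesianProduct)
open import Data.List.Extrema.Nat using (max)
open import Data.List.Membership.Propositional.Properties using (∈-allFin)
open import Data.List.Relation.Unary.AllPairs using (AllPairs; allPairs?)
import Data.List.Relation.Unary.Any as Any
open import Data.List.Relation.Unary.Enumerates.Setoid using (IsEnumeration)
import Data.List.Relation.Unary.Enumerates.Setoid.Properties as Enum
import Data.List.Relation.Unary.Unique.DecSetoid as UniqueDec
open import Data.Nat.Base using (ℕ; suc; _≤_; s≤s)
import Data.Nat.Properties as ℕ
open import Data.Product.Base using (_×_; _,_; ∃-syntax)
open import Data.Sum.Base using (_⊎_; inj₁; inj₂; [_,_]; swap)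
open import Data.Sum.Relation.Binary.Pointwise
  using (Pointwise; inj₁; inj₂; ⊎-decSetoid)
open import Data.Unit.Base using (⊤; tt)
open import Level using (0ℓ)
open import Relation.Binary.Bundles using (DecSetoid)
open import Relation.Binary.Core using (Rel)
open import Relation.Binary.Definitions
  using (Decidable; Irreflexive; Symmetric; _Respects₂_; _Respectsˡ_)
open import Relation.Binary.PropositionalEquality
  using (_≡_; _≢_; refl; sym; trans; subst; ≢-sym)
open import Relation.Nullary.Decidable using (yes; map′; ¬?; _×-dec_; _⊎-dec_)
open import Relation.Nullary.Negation using (¬_)
import Relation.Unary as Unary

-- Finite simple graphs.  Vertices carry a decidable setoid equality so that
-- unordered pairs of vertices can again serve as vertices.  The enumeration
-- may list a vertex more than once.

record Graph : Set₁ where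
  infix 4 _~_ _~?_
  field
    vertices : DecSetoid 0ℓ 0ℓ

  open DecSetoid vertices public
    using (_≈_; _≟_; setoid)
    renaming (Carrier to Vertex; refl to ≈-refl; sym to ≈-sym; trans to ≈-trans)

  field
    elements    : List Vertex
    enumeration : IsEnumeration setoid elements
    _~_         : Rel Vertex 0ℓ
    ~-resp-≈    : _~_ Respects₂ _≈_
    ~-sym       : Symmetric _~_
    ~-irrefl    : Irreflexive _≈_ _~_
    _~?_        : Decidable _~_

-- A finite set of vertices is a list without repetitions (up to _≈_).

module _ (G : Graph) where
  open Graph G
  open UniqueDec vertices using (Unique; unique?)

  Independent : Unary.Pred (List Vertex) 0ℓ
  Independent S = Unique S × AllPairs (λ u v → ¬ (u ~ v)) S

  independent? : Unary.Decidable Independent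
  independent? S = unique? S ×-dec allPairs? (λ u v → ¬? (u ~? v)) S

sublists : {A : Set} → List A → List (List A)
sublists []       = [] ∷ []
sublists (x ∷ xs) = sublists xs ++ map (x ∷_) (sublists xs)

α : Graph → ℕ
α G = max 0 (map length (filter (independent? G) (sublists (Graph.elements G))))

-- The 2-multiset {x,y} is represented by (x , y), taken up to order.

module _ (G : Graph) where
  open Graph G

  infix 4 _≋_

  _≋_ : Rel (Vertex × Vertex) 0ℓ
  (x , y) ≋ (u , v) = (x ≈ u × y ≈ v) ⊎ (x ≈ v × y ≈ u)

  ≋-sym : Symmetric _≋_
  ≋-sym (inj₁ (p , q)) = inj₁ (≈-sym p , ≈-sym q)
  ≋-sym (inj₂ (p , q)) = inj₂ (≈-sym q , ≈-sym p)

  ≋-trans : ∀ {P Q R} → P ≋ Q → Q ≋ R → P ≋ R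
  ≋-trans (inj₁ (p , q)) (inj₁ (r , s)) = inj₁ (≈-trans p r , ≈-trans q s)
  ≋-trans (inj₁ (p , q)) (inj₂ (r , s)) = inj₂ (≈-trans p r , ≈-trans q s)
  ≋-trans (inj₂ (p , q)) (inj₁ (r , s)) = inj₂ (≈-trans p s , ≈-trans q r)
  ≋-trans (inj₂ (p , q)) (inj₂ (r , s)) = inj₁ (≈-trans p s , ≈-trans q r)

  2-multisets : DecSetoid 0ℓ 0ℓ
  2-multisets = record
    { Carrier = Vertex × Vertex
    ; _≈_     = _≋_
    ; isDecEquivalence = record
      { isEquivalence = record
        { refl  = inj₁ (≈-refl , ≈-refl)
        ; sym   = ≋-sym
        ; trans = λ {P} {Q} {R} → ≋-trans {P} {Q} {R}
        }
      ; _≟_ = λ (x , y) (u , v) →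
          ((x ≟ u) ×-dec (y ≟ v)) ⊎-dec ((x ≟ v) ×-dec (y ≟ u))
      }
    }

  PairAdj : Rel (Vertex × Vertex) 0ℓ
  PairAdj P Q = ∃[ a ] ∃[ y ] ∃[ v ] (P ≋ (a , y)) × (Q ≋ (a , v)) × y ~ v

  private
    ~-resp : ∀ {x x′ y y′} → x ≈ x′ → y ≈ y′ → x ~ y → x′ ~ y′
    ~-resp p q r = let (respʳ , respˡ) = ~-resp-≈ in respˡ p (respʳ q r)

    Cases : Rel (Vertex × Vertex) 0ℓ
    Cases (x , y) (u , v) =
      ((x ≈ u × y ~ v) ⊎ (x ≈ v × y ~ u)) ⊎ ((y ≈ u × x ~ v) ⊎ (y ≈ v × x ~ u))

    fromCases : ∀ P Q → Cases P Q → PairAdj P Q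
    fromCases (x , y) (u , v) (inj₁ (inj₁ (e , r))) =
      x , y , v , inj₁ (≈-refl , ≈-refl) , inj₁ (≈-sym e , ≈-refl) , r
    fromCases (x , y) (u , v) (inj₁ (inj₂ (e , r))) =
      x , y , u , inj₁ (≈-refl , ≈-refl) , inj₂ (≈-refl , ≈-sym e) , r
    fromCases (x , y) (u , v) (inj₂ (inj₁ (e , r))) =
      y , x , v , inj₂ (≈-refl , ≈-refl) , inj₁ (≈-sym e , ≈-refl) , r
    fromCases (x , y) (u , v) (inj₂ (inj₂ (e , r))) =
      y , x , u , inj₂ (≈-refl , ≈-refl) , inj₂ (≈-refl , ≈-sym e) , r

    toCases : ∀ P Q → PairAdj P Q → Cases P Q
    toCases _ _ (_ , _ , _ , inj₁ (p , q) , inj₁ (r , s) , e) =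
      inj₁ (inj₁ (≈-trans p (≈-sym r) , ~-resp (≈-sym q) (≈-sym s) e))
    toCases _ _ (_ , _ , _ , inj₁ (p , q) , inj₂ (r , s) , e) =
      inj₁ (inj₂ (≈-trans p (≈-sym s) , ~-resp (≈-sym q) (≈-sym r) e))
    toCases _ _ (_ , _ , _ , inj₂ (p , q) , inj₁ (r , s) , e) =
      inj₂ (inj₁ (≈-trans q (≈-sym r) , ~-resp (≈-sym p) (≈-sym s) e))
    toCases _ _ (_ , _ , _ , inj₂ (p , q) , inj₂ (r , s) , e) =
      inj₂ (inj₂ (≈-trans q (≈-sym s) , ~-resp (≈-sym p) (≈-sym r) e))

  -- Adjacent vertices y and v are distinct, so {a,y} ∩ {a,v} = {a} holds
  -- automatically in PairAdj.
  C : Graph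
  C = record
    { vertices    = 2-multisets
    ; elements    = cartesianProduct elements elements
    ; enumeration = λ P → Any.map inj₁
        (Enum.cartesianProduct⁺ setoid setoid enumeration enumeration P)
    ; _~_         = PairAdj
    ; ~-resp-≈    =
        (λ {P} {Q} {R} Q≋R (a , y , v , p , q , r) →
           a , y , v , p , ≋-trans {R} {Q} {a , v} (≋-sym {Q} {R} Q≋R) q , r)
      , (λ {P} {Q} {R} Q≋R (a , y , v , p , q , r) →
           a , y , v , ≋-trans {R} {Q} {a , y} (≋-sym {Q} {R} Q≋R) p , q , r)
    ; ~-sym       = λ (a , y , v , p , q , r) → a , v , y , q , p , ~-sym r
    ; ~-irrefl    = λ {P} {Q} P≋Q (a , y , v , p , q , r) →
        irrefl {a} {y} {v}
          (≋-trans {a , y} {Q} {a , v}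
            (≋-trans {a , y} {P} {Q} (≋-sym {P} {a , y} p) P≋Q) q) r
    ; _~?_        = λ where
        P@(x , y) Q@(u , v) → map′ (fromCases P Q) (toCases P Q)
          ((((x ≟ u) ×-dec (y ~? v)) ⊎-dec ((x ≟ v) ×-dec (y ~? u)))
           ⊎-dec (((y ≟ u) ×-dec (x ~? v)) ⊎-dec ((y ≟ v) ×-dec (x ~? u))))
    }
    where
    irrefl : ∀ {a y v} → (a , y) ≋ (a , v) → ¬ (y ~ v)
    irrefl (inj₁ (_ , y≈v))   = ~-irrefl y≈v
    irrefl (inj₂ (a≈v , y≈a)) = ~-irrefl (≈-trans y≈a a≈v)

module _ {n : ℕ} where

  -- i + 1 = j in ℤ/n.
  Next : Rel (Fin n) 0ℓ
  Next i j = (suc (toℕ i) ≡ toℕ j) ⊎ (suc (toℕ i) ≡ n × toℕ j ≡ 0)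

  next? : Decidable Next
  next? i j = (suc (toℕ i) ℕ.≟ toℕ j) ⊎-dec ((suc (toℕ i) ℕ.≟ n) ×-dec (toℕ j ℕ.≟ 0))

finGraph : (n : ℕ) (_~_ : Rel (Fin n) 0ℓ) →
           Symmetric _~_ → Irreflexive _≡_ _~_ → Decidable _~_ → Graph
finGraph n _~_ ~-sym ~-irrefl _~?_ = record
  { vertices    = Fin.≡-decSetoid n
  ; elements    = allFin n
  ; enumeration = ∈-allFin
  ; _~_         = _~_
  ; ~-resp-≈    = (λ { refl r → r }) , (λ { refl r → r })
  ; ~-sym       = ~-sym
  ; ~-irrefl    = ~-irrefl
  ; _~?_        = _~?_
  }

cycle : (m : ℕ) → 3 ≤ m → Graph
cycle m m≥3 = finGraph m (λ i j → Next i j ⊎ Next j i) swap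
  (λ { refl → [ irrefl m≥3 , irrefl m≥3 ] })
  (λ i j → next? i j ⊎-dec next? j i)
  where
  irrefl : 3 ≤ m → ∀ {i : Fin m} → ¬ Next i i
  irrefl _   (inj₁ e)       = ℕ.1+n≢n e
  irrefl 3≤m (inj₂ (e , z)) with trans (sym e) (subst (λ k → suc k ≡ 1) (sym z) refl)
  irrefl (s≤s ()) (inj₂ _) | refl

complete : ℕ → Graph
complete n = finGraph n _≢_ ≢-sym (λ p q → q p) (λ i j → ¬? (i Fin.≟ j))

module _ (G H : Graph) where
  private
    module G = Graph G
    module H = Graph H

  JoinAdj : Rel (G.Vertex ⊎ H.Vertex) 0ℓ
  JoinAdj (inj₁ x) (inj₁ y) = x G.~ y
  JoinAdj (inj₁ _) (inj₂ _) = ⊤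
  JoinAdj (inj₂ _) (inj₁ _) = ⊤
  JoinAdj (inj₂ x) (inj₂ y) = x H.~ y

  private
    joinAdj-sym : Symmetric JoinAdj
    joinAdj-sym {inj₁ _} {inj₁ _} r = G.~-sym r
    joinAdj-sym {inj₁ _} {inj₂ _} _ = tt
    joinAdj-sym {inj₂ _} {inj₁ _} _ = tt
    joinAdj-sym {inj₂ _} {inj₂ _} r = H.~-sym r

    joinAdj-respˡ : JoinAdj Respectsˡ Pointwise G._≈_ H._≈_
    joinAdj-respˡ {inj₁ _} (inj₁ e) r = let (_ , respˡ) = G.~-resp-≈ in respˡ e r
    joinAdj-respˡ {inj₂ _} (inj₁ _) _ = tt
    joinAdj-respˡ {inj₁ _} (inj₂ _) _ = tt
    joinAdj-respˡ {inj₂ _} (inj₂ e) r = let (_ , respˡ) = H.~-resp-≈ in respˡ e r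

    joinAdj? : Decidable JoinAdj
    joinAdj? (inj₁ x) (inj₁ y) = x G.~? y
    joinAdj? (inj₁ _) (inj₂ _) = yes tt
    joinAdj? (inj₂ _) (inj₁ _) = yes tt
    joinAdj? (inj₂ x) (inj₂ y) = x H.~? y

  join : Graph
  join = record
    { vertices    = ⊎-decSetoid G.vertices H.vertices
    ; elements    = map inj₁ G.elements ++ map inj₂ H.elements
    ; enumeration = Enum.++⁺ G.setoid H.setoid G.enumeration H.enumeration
    ; _~_         = JoinAdj
    ; ~-resp-≈    =
        (λ {x} {y} {z} e r →
           joinAdj-sym {z} {x} (joinAdj-respˡ {x} e (joinAdj-sym {x} {y} r)))
      , (λ {x} → joinAdj-respˡ {x})
    ; ~-sym       = λ {x} {y} → joinAdj-sym {x} {y}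
    ; ~-irrefl    = λ { (inj₁ e) → G.~-irrefl e ; (inj₂ e) → H.~-irrefl e }
    ; _~?_        = joinAdj?
    }

wheel : (m : ℕ) → 3 ≤ m → Graph
wheel m m≥3 = join (cycle m m≥3) (complete 1)

{-# OPTIONS --safe #-}

-- The wheel is C_m with a hub w added, and the cycle structure plays no role.
-- An independent set of C(G) stays independent in C(G + K₁) when {w,w} is
-- added.  Conversely, given an independent set of C(G + K₁), drop {w,w} and
-- replace every {x,w} by {x,x}.  Since {x,w} is adjacent to every {x,y} with y
-- in G, no remaining pair contains x, so {x,x} is new and has no neighbour:
-- the outcome is an independent set of C(G) with at most one element fewer.

module Submission where

open import Defs
open import Data.Empty using (⊥-elim)
open import Data.Fin.Base using (zero)
open import Data.List.Base
  using (List; []; _∷_; _++_; map; mapMaybe; filter; length)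
open import Data.List.Extrema.Nat using (argmax-sel; v≤max⁺)
import Data.List.Membership.DecSetoid as DecMembership
open import Data.List.Membership.Propositional using (_∈_)
open import Data.List.Membership.Propositional.Properties
  using (∈-map⁺; ∈-map⁻; ∈-++⁺ˡ; ∈-++⁺ʳ; ∈-filter⁺; ∈-filter⁻)
open import Data.List.Membership.Setoid.Properties using (∈-∃++)
open import Data.List.Properties using (length-map)
import Data.List.Relation.Binary.Permutation.Setoid as Permutation
import Data.List.Relation.Binary.Permutation.Setoid.Properties as Permutationₚ
open import Data.List.Relation.Unary.All as All using (All; []; _∷_)
import Data.List.Relation.Unary.All.Properties as All
open import Data.List.Relation.Unary.AllPairs as AllPairs using (AllPairs; []; _∷_)
import Data.List.Relation.Unary.AllPairs.Properties as AllPairs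
open import Data.List.Relation.Unary.Any as Any using (here; there)
open import Data.Maybe.Base using (Maybe; just; nothing)
open import Data.Nat.Base using (ℕ; suc; _+_; _≤_; z≤n; s≤s)
open import Data.Nat.Properties
  using (≤-antisym; ≤-reflexive; +-comm; module ≤-Reasoning)
open import Data.Product.Base using (_×_; _,_; ∃-syntax; proj₁; proj₂)
open import Data.Sum.Base using (_⊎_; inj₁; inj₂)
open import Data.Sum.Relation.Binary.Pointwise using (inj₁; inj₂)
open import Data.Unit.Base using (tt)
open import Function.Base using (_∘_)
open import Level using (0ℓ)
open import Relation.Binary.Core using (Rel)
open import Relation.Binary.Bundles using (DecSetoid)
open import Relation.Binary.PropositionalEquality
  using (_≡_; _≢_; refl; sym; trans; cong; subst)
open import Relation.Nullary.Decidable using (yes; no)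
open import Relation.Nullary.Negation using (¬_)

-- Pairwise properties and lengths under `mapMaybe`

module _ {A B : Set} (f : A → Maybe B) where

  AllPairs-mapMaybe⁺ : {R : Rel A 0ℓ} {S : Rel B 0ℓ} →
    (∀ {x y u v} → f x ≡ just u → f y ≡ just v → R x y → S u v) →
    ∀ {xs} → AllPairs R xs → AllPairs S (mapMaybe f xs)
  AllPairs-mapMaybe⁺ {R} {S} pres = go
    where
    rest : ∀ {x u xs} → f x ≡ just u → All (R x) xs → All (S u) (mapMaybe f xs)
    rest _  [] = []
    rest {xs = y ∷ _} fx (r ∷ rs) with f y in fy
    ... | nothing = rest fx rs
    ... | just _  = pres fx fy r ∷ rest fx rs

    go : ∀ {xs} → AllPairs R xs → AllPairs S (mapMaybe f xs)
    go [] = []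
    go {x ∷ _} (r ∷ rs) with f x in fx
    ... | nothing = go rs
    ... | just _  = rest fx r ∷ go rs

  length≤length-mapMaybe : ∀ {xs} → All (λ x → f x ≢ nothing) xs →
                           length xs ≤ length (mapMaybe f xs)
  length≤length-mapMaybe [] = z≤n
  length≤length-mapMaybe {x ∷ _} (fx≢ ∷ fxs≢) with f x
  ... | nothing = ⊥-elim (fx≢ refl)
  ... | just _  = s≤s (length≤length-mapMaybe fxs≢)

  -- The hypothesis lets `f` drop at most one entry: once one is dropped, every later one is kept.
  length≤1+length-mapMaybe : ∀ {xs} →
    AllPairs (λ x y → f x ≡ nothing → f y ≢ nothing) xs →
    length xs ≤ suc (length (mapMaybe f xs))
  length≤1+length-mapMaybe [] = z≤n
  length≤1+length-mapMaybe {x ∷ _} (r ∷ rs) with f x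
  ... | nothing = s≤s (length≤length-mapMaybe (All.map (λ s → s refl) r))
  ... | just _  = s≤s (length≤1+length-mapMaybe rs)

-- Repetition-free lists as sublists of an enumeration

module _ (D : DecSetoid 0ℓ 0ℓ) where
  open DecSetoid D using (setoid; _≈_) renaming (Carrier to A; trans to ≈-trans; sym to ≈-sym)
  open DecMembership D using (_∈?_) renaming (_∈_ to _∈ₛ_)
  open Permutation setoid
    using (_↭_; ↭-refl; ↭-sym; ↭-trans; ↭-prep; ↭-reflexive-≋)
  open Permutationₚ setoid using (Unique-resp-↭; ∈-resp-↭; shift)
  open import Data.List.Relation.Unary.Unique.Setoid setoid using (Unique)

  -- `α` inspects only sublists of one fixed enumeration, so an arbitrary vertex set has to be
  -- matched with such a sublist. Induction on `xs`: its head is taken exactly when it occurs in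
  -- `S`, and is then removed from `S`.
  unique-↭-sublist : ∀ xs {S} → Unique S → (∀ {x} → x ∈ₛ S → x ∈ₛ xs) →
                     ∃[ T ] T ∈ sublists xs × S ↭ T
  unique-↭-sublist [] {[]} _ _ = [] , here refl , ↭-refl
  unique-↭-sublist [] {_ ∷ _} _ S⊆ with () ← S⊆ (here (DecSetoid.refl D))
  unique-↭-sublist (x ∷ xs) {S} S! S⊆ with x ∈? S
  ... | no x∉S =
    let T , T∈ , S↭T = unique-↭-sublist xs S! S⊆xs
    in T , ∈-++⁺ˡ T∈ , S↭T
    where
    S⊆xs : ∀ {y} → y ∈ₛ S → y ∈ₛ xs
    S⊆xs y∈S with S⊆ y∈S
    ... | here y≈x = ⊥-elim (x∉S (Any.map (≈-trans (≈-sym y≈x)) y∈S))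
    ... | there y∈xs = y∈xs
  ... | yes x∈S with ys , zs , w , x≈w , S≋ ← ∈-∃++ setoid x∈S
    = let T , T∈ , R↭T = unique-↭-sublist xs (AllPairs.tail xR!) R⊆xs
      in x ∷ T , ∈-++⁺ʳ (sublists xs) (∈-map⁺ (x ∷_) T∈)
       , ↭-trans S↭xR (↭-prep x R↭T)
    where
    -- The occurrence `w` of `x` in `S` moves to the front and is replaced by its representative `x`
    -- from `xs`.
    S↭xR : S ↭ x ∷ ys ++ zs
    S↭xR = ↭-trans (↭-reflexive-≋ S≋) (shift (≈-sym x≈w) ys zs)

    xR! : Unique (x ∷ ys ++ zs)
    xR! = Unique-resp-↭ S↭xR S!

    -- As `S` has no repetitions, `x` does not recur in the remainder, which therefore lies in the
    -- tail `xs`.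
    R⊆xs : ∀ {y} → y ∈ₛ (ys ++ zs) → y ∈ₛ xs
    R⊆xs y∈R with S⊆ (∈-resp-↭ (↭-sym S↭xR) (there y∈R))
    ... | there y∈xs = y∈xs
    ... | here y≈x =
      ⊥-elim (All.All¬⇒¬Any (AllPairs.head xR!) (Any.map (≈-trans (≈-sym y≈x)) y∈R))

-- The independence number as an attained upper bound

module _ (G : Graph) where
  open Graph G

  Apart : Rel Vertex 0ℓ
  Apart u v = ¬ (u ≈ v) × ¬ (u ~ v)

  α-attained : ∃[ S ] Independent G S × length S ≡ α G
  α-attained
    with argmax-sel (λ n → n) 0 (map length (filter (independent? G) (sublists elements)))
  -- The default value 0 of `max` is realised by the empty set.
  ... | inj₁ α≡0 = [] , ([] , []) , sym α≡0
  ... | inj₂ α∈  =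
    let S , S∈ , α≡ = ∈-map⁻ length α∈
    in S , proj₂ (∈-filter⁻ (independent? G) {xs = sublists elements} S∈) , sym α≡

  independent⇒length≤α : ∀ {S} → Independent G S → length S ≤ α G
  independent⇒length≤α {S} (S! , S≁) =
    let T , T∈ , S↭T = unique-↭-sublist vertices elements S! (λ _ → enumeration _)
        T-indep = Unique-resp-↭ S↭T S!
                -- Non-adjacency survives reordering because it is symmetric and respects `_≈_`.
                , AllPairs-resp-↭ (_∘ ~-sym)
                    ((λ e ≁ → ≁ ∘ proj₁ ~-resp-≈ (≈-sym e)) , (λ e ≁ → ≁ ∘ proj₂ ~-resp-≈ (≈-sym e)))
                    S↭T S≁
        lengthT∈ = ∈-map⁺ length (∈-filter⁺ (independent? G) T∈ T-indep)
        S≤T = ≤-reflexive (xs↭ys⇒|xs|≡|ys| S↭T)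
    in v≤max⁺ 0 _ (inj₂ (Any.map (λ { refl → S≤T }) lengthT∈))
    where open Permutationₚ setoid

-- Pair graphs of `G` and of its join with one vertex

module _ (G : Graph) where
  private
    W : Graph
    W = join G (complete 1)

    module G  = Graph G
    module W  = Graph W
    module CG = Graph (C G)
    module CW = Graph (C W)

  hub : W.Vertex
  hub = inj₂ zero

  spoke : G.Vertex → CW.Vertex
  spoke x = inj₁ x , hub

  ι : CG.Vertex → CW.Vertex
  ι (x , y) = inj₁ x , inj₁ y

  ι-cong : ∀ {p q} → p CG.≈ q → ι p CW.≈ ι q
  ι-cong (inj₁ (a , b)) = inj₁ (inj₁ a , inj₁ b)
  ι-cong (inj₂ (a , b)) = inj₂ (inj₁ a , inj₁ b)

  ι-injective : ∀ {p q} → ι p CW.≈ ι q → p CG.≈ q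
  ι-injective (inj₁ (inj₁ a , inj₁ b)) = inj₁ (a , b)
  ι-injective (inj₂ (inj₁ a , inj₁ b)) = inj₂ (a , b)

  ι-adj : ∀ {p q} → p CG.~ q → ι p CW.~ ι q
  ι-adj {p} {q} (a , y , v , p≈ , q≈ , y~v) =
    inj₁ a , inj₁ y , inj₁ v , ι-cong {p} {a , y} p≈ , ι-cong {q} {a , v} q≈ , y~v

  -- A hub among the three witnesses would be an entry of `ι p` or `ι q`, whose entries all lie in
  -- `G`.
  ι-adj⁻ : ∀ {p q} → ι p CW.~ ι q → p CG.~ q
  ι-adj⁻ {p} {q} (inj₁ a , inj₁ y , inj₁ v , p≈ , q≈ , y~v) =
    a , y , v , ι-injective {p} {a , y} p≈ , ι-injective {q} {a , v} q≈ , y~v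
  ι-adj⁻ (inj₂ _ , _ , _ , inj₁ (() , _) , _)
  ι-adj⁻ (inj₂ _ , _ , _ , inj₂ (_ , ()) , _)
  ι-adj⁻ (inj₁ _ , inj₂ _ , _ , inj₁ (_ , ()) , _)
  ι-adj⁻ (inj₁ _ , inj₂ _ , _ , inj₂ (() , _) , _)
  ι-adj⁻ (inj₁ _ , inj₁ _ , inj₂ _ , _ , inj₁ (_ , ()) , _)
  ι-adj⁻ (inj₁ _ , inj₁ _ , inj₂ _ , _ , inj₂ (() , _) , _)

  -- Adjacent pairs share an entry, which for the doubled hub must be the hub; `ι p` does not
  -- contain it.
  hub²-apart : ∀ p → Apart (C W) (hub , hub) (ι p)
  hub²-apart p = (λ { (inj₁ ()) ; (inj₂ ()) }) , λ where
    (_ , _ , _ , inj₁ (inj₂ _ , _) , inj₁ (() , _) , _)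
    (_ , _ , _ , inj₁ (inj₂ _ , _) , inj₂ (_ , ()) , _)
    (_ , _ , _ , inj₂ (_ , inj₂ _) , inj₁ (() , _) , _)
    (_ , _ , _ , inj₂ (_ , inj₂ _) , inj₂ (_ , ()) , _)

  -- The positive form of what `Apart` excludes; the collapse is treated by contraposition, pulling
  -- conflicts back from `C G` to `C W`.
  Conflict : (H : Graph) → Rel (Graph.Vertex H) 0ℓ
  Conflict H u v = Graph._≈_ H u v ⊎ Graph._~_ H u v
  
  -- The entry that an adjacent pair shares with `(x , x)` can only be `x`, so every pair in
  -- conflict with it contains `x`.
  conflict-diagonal : ∀ {p x} → Conflict (C G) p (x , x) → ∃[ y ] p CG.≈ (x , y)
  conflict-diagonal {p} {x} (inj₁ p≈) = x , p≈
  conflict-diagonal {p} {x} (inj₂ (a , y , _ , p≈ , e , _)) =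
    y , CG.≈-trans {p} {a , y} {x , y} p≈ (inj₁ (G.≈-sym (x≈ e) , G.≈-refl))
    where
    x≈ : ∀ {v} → (x , x) CG.≈ (a , v) → x G.≈ a
    x≈ (inj₁ (x≈a , _)) = x≈a
    x≈ (inj₂ (_ , x≈a)) = x≈a

  conflict-sym : ∀ H {u v} → Conflict H u v → Conflict H v u
  conflict-sym H (inj₁ e) = inj₁ (Graph.≈-sym H e)
  conflict-sym H (inj₂ r) = inj₂ (Graph.~-sym H r)

  conflict-resp : ∀ H {u u′ v v′} → Graph._≈_ H u u′ → Graph._≈_ H v v′ →
                  Conflict H u v → Conflict H u′ v′
  conflict-resp H u≈ v≈ (inj₁ e) =
    inj₁ (Graph.≈-trans H (Graph.≈-sym H u≈) (Graph.≈-trans H e v≈))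
  conflict-resp H u≈ v≈ (inj₂ r) =
    inj₂ (proj₁ (Graph.~-resp-≈ H) v≈ (proj₂ (Graph.~-resp-≈ H) u≈ r))

  infix 4 _↦_

  -- The collapse up to equality of multisets, so that both orders of a spoke form a single case.
  data _↦_ : CW.Vertex → CG.Vertex → Set where
    from-ι     : ∀ {P} p → ι p CW.≈ P → P ↦ p
    from-spoke : ∀ {P} x → spoke x CW.≈ P → P ↦ (x , x)

  -- Since `p` has the form {x,y}, exchanging `y` for the hub yields the spoke at `x`, and `y` is
  -- joined to the hub.
  spoke-adj : ∀ {p x} → Conflict (C G) p (x , x) → ι p CW.~ spoke x
  spoke-adj {p} {x} c =
    let y , p≈ = conflict-diagonal {p} c
    in inj₁ x , inj₁ y , hub , ι-cong {p} {x , y} p≈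
       , CW.≈-refl {spoke x} , tt

  ↦-reflects-conflict : ∀ {P Q p q} → P ↦ p → Q ↦ q →
                        Conflict (C G) p q → Conflict (C W) P Q
  ↦-reflects-conflict {P} {Q} (from-ι p P≈) (from-ι q Q≈) c =
    conflict-resp (C W) {ι p} {P} {ι q} {Q} P≈ Q≈ (ι-conflict c)
    where
    ι-conflict : Conflict (C G) p q → Conflict (C W) (ι p) (ι q)
    ι-conflict (inj₁ e) = inj₁ (ι-cong {p} {q} e)
    ι-conflict (inj₂ r) = inj₂ (ι-adj {p} {q} r)
  ↦-reflects-conflict {P} {Q} (from-ι p P≈) (from-spoke x Q≈) c =
    conflict-resp (C W) {ι p} {P} {spoke x} {Q} P≈ Q≈ (inj₂ (spoke-adj {p} c))
  ↦-reflects-conflict {P} {Q} (from-spoke x P≈) (from-ι q Q≈) c =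
    conflict-resp (C W) {spoke x} {P} {ι q} {Q} P≈ Q≈
      (conflict-sym (C W) {ι q} {spoke x}
        (inj₂ (spoke-adj {q} (conflict-sym (C G) {x , x} {q} c))))
  -- Two diagonal pairs conflict only if they coincide, since `y` must occur in `(x , x)`; the
  -- spokes are then equal.
  ↦-reflects-conflict {P} {Q} (from-spoke x P≈) (from-spoke y Q≈) c =
    conflict-resp (C W) {spoke x} {P} {spoke y} {Q} P≈ Q≈
      (inj₁ (inj₁ (inj₁ (x≈y (proj₂ (conflict-diagonal {x , x} c))) , W.≈-refl {hub})))
    where
    x≈y : ∀ {z} → (x , x) CG.≈ (y , z) → x G.≈ y
    x≈y (inj₁ (e , _)) = e
    x≈y (inj₂ (_ , e)) = e

  collapse : CW.Vertex → Maybe CG.Vertex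
  collapse (inj₁ x , inj₁ y) = just (x , y)
  collapse (inj₁ x , inj₂ _) = just (x , x)
  collapse (inj₂ _ , inj₁ x) = just (x , x)
  collapse (inj₂ _ , inj₂ _) = nothing

  collapse-↦ : ∀ P {p} → collapse P ≡ just p → P ↦ p
  collapse-↦ P@(inj₁ x , inj₁ y)    refl = from-ι (x , y) (CW.≈-refl {P})
  collapse-↦ P@(inj₁ x , inj₂ zero) refl = from-spoke x (CW.≈-refl {P})
  collapse-↦ (inj₂ zero , inj₁ x)   refl = from-spoke x (inj₂ (W.≈-refl {inj₁ x} , W.≈-refl {hub}))

  collapse-nothing : ∀ P → collapse P ≡ nothing → P ≡ (hub , hub)
  collapse-nothing (inj₁ _ , inj₁ _) ()
  collapse-nothing (inj₂ _ , inj₁ _) ()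
  collapse-nothing (inj₂ zero , inj₂ zero) _ = refl

  collapse-apart : ∀ {P Q p q} → collapse P ≡ just p → collapse Q ≡ just q →
                   Apart (C W) P Q → Apart (C G) p q
  collapse-apart {P} {Q} {p} {q} P↦ Q↦ (P≉Q , P≁Q) =
    (λ e → ¬conflict (inj₁ e)) , (λ r → ¬conflict (inj₂ r))
    where
    ¬conflict : ¬ Conflict (C G) p q
    ¬conflict c with ↦-reflects-conflict (collapse-↦ P P↦) (collapse-↦ Q Q↦) c
    ... | inj₁ e = P≉Q e
    ... | inj₂ r = P≁Q r

  α-join-K₁-≥ : suc (α (C G)) ≤ α (C W)
  α-join-K₁-≥ with S , (S! , S≁) , lengthS ← α-attained (C G) = begin
    suc (α (C G))                         ≡⟨ cong suc (sym lengthS) ⟩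
    suc (length S)                        ≡⟨ cong suc (sym (length-map ι S)) ⟩
    length ((hub , hub) ∷ map ι S)        ≤⟨ independent⇒length≤α (C W) indep ⟩
    α (C W)                               ∎
    where
    open ≤-Reasoning
    indep : Independent (C W) ((hub , hub) ∷ map ι S)
    indep =
        All.map⁺ (All.universal (λ p → proj₁ (hub²-apart p)) S)
          ∷ AllPairs.map⁺ (AllPairs.map (λ {p} {q} p≉q → p≉q ∘ ι-injective {p} {q}) S!)
      , All.map⁺ (All.universal (λ p → proj₂ (hub²-apart p)) S)
          ∷ AllPairs.map⁺ (AllPairs.map (λ {p} {q} p≁q → p≁q ∘ ι-adj⁻ {p} {q}) S≁)

  α-join-K₁-≤ : α (C W) ≤ suc (α (C G))
  α-join-K₁-≤ with S , (S! , S≁) , lengthS ← α-attained (C W) = begin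
    α (C W)                               ≡⟨ sym lengthS ⟩
    length S                              ≤⟨ length≤1+length-mapMaybe collapse one-hub² ⟩
    suc (length (mapMaybe collapse S))    ≤⟨ s≤s (independent⇒length≤α (C G) indep) ⟩
    suc (α (C G))                         ∎
    where
    open ≤-Reasoning

    -- Only the doubled hub is dropped, and `S` lists it at most once.
    one-hub² : AllPairs (λ P Q → collapse P ≡ nothing → collapse Q ≢ nothing) S
    one-hub² = AllPairs.map
      (λ {P} {Q} P≉Q P↦ Q↦ → P≉Q (subst (P CW.≈_)
        (trans (collapse-nothing P P↦) (sym (collapse-nothing Q Q↦))) (CW.≈-refl {P})))
      S!

    -- Distinctness and non-adjacency are carried together: equal images, such as those of {x,x} and
    -- a spoke at `x`, may come from distinct pairs and are excluded only by non-adjacency.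
    indep : Independent (C G) (mapMaybe collapse S)
    indep = AllPairs.unzip
      (AllPairs-mapMaybe⁺ collapse
        (λ {P} {Q} → collapse-apart {P} {Q}) (AllPairs.zip (S! , S≁)))

  α-join-K₁ : α (C W) ≡ α (C G) + 1
  α-join-K₁ = trans (≤-antisym α-join-K₁-≤ α-join-K₁-≥) (+-comm 1 (α (C G)))

theorem1p6 : (m : ℕ) (m≥3 : 3 ≤ m) → α (C (wheel m m≥3)) ≡ α (C (cycle m m≥3)) + 1
theorem1p6 m m≥3 = α-join-K₁ (cycle m m≥3)
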